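{- Any two equivalent categories agree on homotopic sentences. That is, let $\mathbb C$ and $\mathbb D$ be equivalent categories, with respective iso-graphs $\mathbbm i\subseteq\mathbb C$ and $\mathbbm j\subseteq\mathbb D$. Then for every homotopic sentence $\sigma$ (without parameters), $\sigma$ holds in $\mathbb C$ (with the ternary predicate interpreted as $\mathrm{QC}_{\mathbbm i}$) if and only if $\sigma$ holds in $\mathbb D$ (with the ternary predicate interpreted as $\mathrm{QC}_{\mathbbm j}$).
   Context: Categories here have a set of objects and a set of morphisms. An iso-graph of a category $\mathbb C$ is a subcategory $\mathbbm i$ that is wide (same objects as $\mathbb C$) and thin (each hom-set has at most one element), such that $\mathrm{Hom}_{\mathbbm i}(A,B)\neq\emptyset$ if and only if $A\cong B$ in $\mathbb C$. (All morphisms of $\mathbbm i$ are then isomorphisms; iso-graphs exist by the axiom of choice.) Given an iso-graph $\mathbbm i$ and morphisms $f\colon A\to B$, $g\colon C\to D$, $h\colon P\to Q$ of $\mathbb C$, the predicate $\mathrm{QC}_{\mathbbm i}(f,g,h)$ (quasi-composition) holds if there exist $\mathbbm i$-morphisms $\alpha\colon P\to A$, $\gamma\colon B\to C$, $\delta\colon Q\to D$ such that $\delta\circ h=g\circ\gamma\circ f\circ\alpha$. A homotopic formula is a first-order formula, with variables ranging over the morphisms of the category, built from atomic formulas $\mathrm{QC}(x,y,z)$ using Boolean combinations and (unrestricted) quantification; equality is not allowed. A homotopic sentence is a homotopic formula without free variables. -}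

module Defs where

open import Level using (Level; _⊔_; suc; Lift)
open import Data.Empty using (⊥)
open import Data.Fin.Base using (Fin)
open import Data.Nat.Base as ℕ using (ℕ)
open import Data.Product.Base using (Σ; ∃; _×_)
open import Data.Sum.Base using (_⊎_)
open import Data.Vec.Base using (Vec; []; _∷_; lookup)
open import Function.Bundles using (_⇔_)
open import Relation.Binary.Core using (Rel)
open import Relation.Binary.Structures using (IsEquivalence)
open import Relation.Nullary.Negation.Core using (¬_)

private
  variable
    o ℓ e o′ ℓ′ e′ p a r : Level
    n : ℕ

-- Each hom-set is a setoid: equality of parallel morphisms is _≈_.
record Category (o ℓ e : Level) : Set (suc (o ⊔ ℓ ⊔ e)) where
  infix  4 _≈_ _⇒_
  infixr 9 _∘_
  field
    Obj       : Set o
    _⇒_       : Obj → Obj → Set ℓ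
    _≈_       : ∀ {A B} → Rel (A ⇒ B) e
    id        : ∀ {A} → A ⇒ A
    _∘_       : ∀ {A B C} → B ⇒ C → A ⇒ B → A ⇒ C
    equiv     : ∀ {A B} → IsEquivalence (_≈_ {A} {B})
    ∘-resp-≈  : ∀ {A B C} {f h : B ⇒ C} {g i : A ⇒ B} →
                f ≈ h → g ≈ i → f ∘ g ≈ h ∘ i
    assoc     : ∀ {A B C D} {f : A ⇒ B} {g : B ⇒ C} {h : C ⇒ D} →
                (h ∘ g) ∘ f ≈ h ∘ (g ∘ f)
    identityˡ : ∀ {A B} {f : A ⇒ B} → id ∘ f ≈ f
    identityʳ : ∀ {A B} {f : A ⇒ B} → f ∘ id ≈ f

module _ (C : Category o ℓ e) where
  open Category C

  record IsIso {A B : Obj} (f : A ⇒ B) : Set (ℓ ⊔ e) where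
    field
      inv  : B ⇒ A
      isoˡ : inv ∘ f ≈ id
      isoʳ : f ∘ inv ≈ id

  Isomorphic : Obj → Obj → Set (ℓ ⊔ e)
  Isomorphic A B = Σ (A ⇒ B) IsIso

  record Arrow : Set (o ⊔ ℓ) where
    constructor arrow
    field
      {dom} {cod} : Obj
      hom         : dom ⇒ cod

  -- A wide subcategory has all the objects, so it is given by its morphisms.
  record WideSubcategory (p : Level) : Set (o ⊔ ℓ ⊔ e ⊔ suc p) where
    field
      Member : ∀ {A B} → A ⇒ B → Set p
      resp-≈ : ∀ {A B} {f g : A ⇒ B} → f ≈ g → Member f → Member g
      id∈    : ∀ {A} → Member (id {A})
      ∘∈     : ∀ {A B C} {g : B ⇒ C} {f : A ⇒ B} →
               Member g → Member f → Member (g ∘ f)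

  record IsoGraph (p : Level) : Set (o ⊔ ℓ ⊔ e ⊔ suc p) where
    field
      wideSubcategory : WideSubcategory p
    open WideSubcategory wideSubcategory public
    field
      thin      : ∀ {A B} {f g : A ⇒ B} → Member f → Member g → f ≈ g
      connected : ∀ A B → (∃ λ (f : A ⇒ B) → Member f) ⇔ Isomorphic A B

  QC : IsoGraph p → Arrow → Arrow → Arrow → Set (ℓ ⊔ e ⊔ p)
  QC i (arrow {A} {B} f) (arrow {C′} {D} g) (arrow {P} {Q} h) =
    Σ (P ⇒ A) λ α → Σ (B ⇒ C′) λ γ → Σ (Q ⇒ D) λ δ →
      Member α × Member γ × Member δ × (δ ∘ h ≈ g ∘ γ ∘ f ∘ α)
    where open IsoGraph i

record Functor (C : Category o ℓ e) (D : Category o′ ℓ′ e′) :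
               Set (o ⊔ ℓ ⊔ e ⊔ o′ ⊔ ℓ′ ⊔ e′) where
  private
    module C = Category C
    module D = Category D
  field
    F₀           : C.Obj → D.Obj
    F₁           : ∀ {A B} → A C.⇒ B → F₀ A D.⇒ F₀ B
    F-resp-≈     : ∀ {A B} {f g : A C.⇒ B} → f C.≈ g → F₁ f D.≈ F₁ g
    identity     : ∀ {A} → F₁ (C.id {A}) D.≈ D.id
    homomorphism : ∀ {X Y Z} {f : X C.⇒ Y} {g : Y C.⇒ Z} →
                   F₁ (g C.∘ f) D.≈ F₁ g D.∘ F₁ f

idF : (C : Category o ℓ e) → Functor C C
idF C = record
  { F₀           = λ A → A
  ; F₁           = λ f → f
  ; F-resp-≈     = λ eq → eq
  ; identity     = IsEquivalence.refl equiv
  ; homomorphism = IsEquivalence.refl equiv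
  }
  where open Category C

infixr 9 _∘F_
_∘F_ : ∀ {o₁ ℓ₁ e₁ o₂ ℓ₂ e₂ o₃ ℓ₃ e₃}
       {C : Category o₁ ℓ₁ e₁} {D : Category o₂ ℓ₂ e₂} {E : Category o₃ ℓ₃ e₃} →
       Functor D E → Functor C D → Functor C E
_∘F_ {E = E} G F = record
  { F₀           = λ A → G.F₀ (F.F₀ A)
  ; F₁           = λ f → G.F₁ (F.F₁ f)
  ; F-resp-≈     = λ eq → G.F-resp-≈ (F.F-resp-≈ eq)
  ; identity     = trans (G.F-resp-≈ F.identity) G.identity
  ; homomorphism = trans (G.F-resp-≈ F.homomorphism) G.homomorphism
  }
  where
  module F = Functor F
  module G = Functor G
  trans : ∀ {A B} {f g h : Category._⇒_ E A B} →
          Category._≈_ E f g → Category._≈_ E g h → Category._≈_ E f h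
  trans = IsEquivalence.trans (Category.equiv E)

record NaturalIsomorphism {C : Category o ℓ e} {D : Category o′ ℓ′ e′}
                          (F G : Functor C D) :
                          Set (o ⊔ ℓ ⊔ ℓ′ ⊔ e′) where
  private
    module C = Category C
    module D = Category D
    module F = Functor F
    module G = Functor G
  field
    η       : ∀ X → F.F₀ X D.⇒ G.F₀ X
    natural : ∀ {X Y} (f : X C.⇒ Y) → η Y D.∘ F.F₁ f D.≈ G.F₁ f D.∘ η X
    iso     : ∀ X → IsIso D (η X)

record Equivalence (C : Category o ℓ e) (D : Category o′ ℓ′ e′) :
                   Set (o ⊔ ℓ ⊔ e ⊔ o′ ⊔ ℓ′ ⊔ e′) where
  field
    F      : Functor C D
    G      : Functor D C
    unit   : NaturalIsomorphism (idF C) (G ∘F F)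
    counit : NaturalIsomorphism (F ∘F G) (idF D)

-- Formulas with n free variables in de Bruijn style: a quantifier binds the
-- variable zero of its body.
data Formula (n : ℕ) : Set where
  qc          : Fin n → Fin n → Fin n → Formula n
  ⊥′          : Formula n
  ¬′_         : Formula n → Formula n
  _∧′_ _∨′_   : Formula n → Formula n → Formula n
  _→′_        : Formula n → Formula n → Formula n
  ∀′_ ∃′_     : Formula (ℕ.suc n) → Formula n

Sentence : Set
Sentence = Formula 0

-- Lift only equalises universe levels.
module _ {M : Set a} (R : M → M → M → Set r) where

  Satisfies : Vec M n → Formula n → Set (a ⊔ r)
  Satisfies ρ (qc x y z) = Lift a (R (lookup ρ x) (lookup ρ y) (lookup ρ z))
  Satisfies ρ ⊥′         = Lift (a ⊔ r) ⊥
  Satisfies ρ (¬′ φ)     = ¬ Satisfies ρ φ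
  Satisfies ρ (φ ∧′ ψ)   = Satisfies ρ φ × Satisfies ρ ψ
  Satisfies ρ (φ ∨′ ψ)   = Satisfies ρ φ ⊎ Satisfies ρ ψ
  Satisfies ρ (φ →′ ψ)   = Satisfies ρ φ → Satisfies ρ ψ
  Satisfies ρ (∀′ φ)     = ∀ x → Satisfies (x ∷ ρ) φ
  Satisfies ρ (∃′ φ)     = ∃ λ x → Satisfies (x ∷ ρ) φ

Holds : (C : Category o ℓ e) → IsoGraph C p → Sentence → Set (o ⊔ ℓ ⊔ e ⊔ p)
Holds C i σ = Satisfies (QC C i) [] σ

-- An equivalence F need not map i into j, and correcting it globally would need
-- a choice of representatives of isomorphism classes.  A sentence only ever
-- inspects finitely many objects, so a back-and-forth argument suffices: keep a
-- finite list of isomorphisms w : F A → A′ along which the members of i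
-- correspond to members of j.  A new object isomorphic to one already
-- listed is linked by transport along the iso-graph; one that is not may be
-- linked by any isomorphism.  Excluded middle decides which case applies.
module Submission where

open import Defs
open import Axiom.ExcludedMiddle using (ExcludedMiddle)
open import Data.Fin.Base using (Fin)
open import Data.List.Base using (List; []; _∷_)
open import Data.List.Membership.Propositional using (_∈_)
open import Data.List.Relation.Binary.Subset.Propositional using (_⊆_)
open import Data.List.Relation.Unary.Any using (here; there)
open import Data.Product.Base using (Σ; ∃; ∃₂; _×_; _,_; proj₁; proj₂)
open import Data.Sum.Base as Sum using ()
open import Data.Vec.Base using (Vec; []; _∷_; lookup)
open import Data.Vec.Relation.Binary.Pointwise.Inductive as Pointwise
  using (Pointwise; []; _∷_)
open import Function.Base using (_∘′_)
open import Function.Bundles using (_⇔_; mk⇔)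
import Function.Bundles as Bundles
open import Level using (Level; _⊔_; lift)
open import Relation.Binary.Bundles using (Setoid)
open import Relation.Binary.PropositionalEquality.Core using (refl)
open import Relation.Binary.Structures using (IsEquivalence)
import Relation.Binary.Reasoning.Setoid as SetoidReasoning
open import Relation.Nullary.Decidable.Core using (yes; no)
open import Relation.Nullary.Negation.Core using (contradiction)

private
  module ⇔ = Bundles.Equivalence

-- Back-and-forth systems and satisfaction of formulas

record BackAndForth {a b r s} {M : Set a} {N : Set b}
                    (R : M → M → M → Set r) (S : N → N → N → Set s) (z : Level) :
                    Set (a ⊔ b ⊔ r ⊔ s ⊔ Level.suc z) where
  field
    _∼_   : ∀ {n} → Vec M n → Vec N n → Set z
    atoms : ∀ {n} {ρ : Vec M n} {τ} → ρ ∼ τ → (x y z : Fin n) →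
            R (lookup ρ x) (lookup ρ y) (lookup ρ z) ⇔
            S (lookup τ x) (lookup τ y) (lookup τ z)
    forth : ∀ {n} {ρ : Vec M n} {τ} → ρ ∼ τ → ∀ x → ∃ λ y → (x ∷ ρ) ∼ (y ∷ τ)
    back  : ∀ {n} {ρ : Vec M n} {τ} → ρ ∼ τ → ∀ y → ∃ λ x → (x ∷ ρ) ∼ (y ∷ τ)

  -- The two directions are proved by mutual induction because negation and the premise of an
  -- implication reverse them. Going forward, `∀′` needs a preimage of a given element and uses
  -- `back`, while `∃′` carries a witness along `forth`.
  satisfies-to   : ∀ {n} {ρ : Vec M n} {τ} → ρ ∼ τ → ∀ φ →
                   Satisfies R ρ φ → Satisfies S τ φ
  satisfies-from : ∀ {n} {ρ : Vec M n} {τ} → ρ ∼ τ → ∀ φ →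
                   Satisfies S τ φ → Satisfies R ρ φ

  satisfies-to s (qc x y z) (lift h)  = lift (⇔.to (atoms s x y z) h)
  satisfies-to s (¬′ φ)     h k       = h (satisfies-from s φ k)
  satisfies-to s (φ ∧′ ψ)   (h , k)   = satisfies-to s φ h , satisfies-to s ψ k
  satisfies-to s (φ ∨′ ψ)   h         = Sum.map (satisfies-to s φ) (satisfies-to s ψ) h
  satisfies-to s (φ →′ ψ)   h k       = satisfies-to s ψ (h (satisfies-from s φ k))
  satisfies-to s (∀′ φ)     h y       = let x , s′ = back s y in satisfies-to s′ φ (h x)
  satisfies-to s (∃′ φ)     (x , h)   = let y , s′ = forth s x in y , satisfies-to s′ φ h

  satisfies-from s (qc x y z) (lift h) = lift (⇔.from (atoms s x y z) h)
  satisfies-from s (¬′ φ)     h k      = h (satisfies-to s φ k)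
  satisfies-from s (φ ∧′ ψ)   (h , k)  = satisfies-from s φ h , satisfies-from s ψ k
  satisfies-from s (φ ∨′ ψ)   h        = Sum.map (satisfies-from s φ) (satisfies-from s ψ) h
  satisfies-from s (φ →′ ψ)   h k      = satisfies-from s ψ (h (satisfies-to s φ k))
  satisfies-from s (∀′ φ)     h x      = let y , s′ = forth s x in satisfies-from s′ φ (h y)
  satisfies-from s (∃′ φ)     (y , h)  = let x , s′ = back s y in x , satisfies-from s′ φ h

-- Cancellation and isomorphisms in a category

module CategoryProperties {o ℓ e} (C : Category o ℓ e) where
  open Category C

  homSetoid : Obj → Obj → Setoid ℓ e
  homSetoid A B = record { isEquivalence = equiv {A} {B} }

  module ≈ {A B} = IsEquivalence (equiv {A} {B})
  module HomReasoning {A B} = SetoidReasoning (homSetoid A B)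
  open HomReasoning

  infixr 9 refl⟩∘⟨_
  infixl 9 _⟩∘⟨refl

  refl⟩∘⟨_ : ∀ {A B D} {f : B ⇒ D} {g h : A ⇒ B} → g ≈ h → f ∘ g ≈ f ∘ h
  refl⟩∘⟨ eq = ∘-resp-≈ ≈.refl eq

  _⟩∘⟨refl : ∀ {A B D} {f g : B ⇒ D} {h : A ⇒ B} → f ≈ g → f ∘ h ≈ g ∘ h
  eq ⟩∘⟨refl = ∘-resp-≈ eq ≈.refl

  cancelˡ : ∀ {A B D} {f : B ⇒ D} {g : D ⇒ B} {h : A ⇒ B} →
            g ∘ f ≈ id → g ∘ (f ∘ h) ≈ h
  cancelˡ eq = ≈.trans (≈.sym assoc) (≈.trans (eq ⟩∘⟨refl) identityˡ)

  cancelʳ : ∀ {A B D} {f : B ⇒ D} {g : D ⇒ B} {h : B ⇒ A} →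
            g ∘ f ≈ id → (h ∘ g) ∘ f ≈ h
  cancelʳ eq = ≈.trans assoc (≈.trans (refl⟩∘⟨ eq) identityʳ)

  iso⇒mono : ∀ {A B D} {w : B ⇒ D} {f g : A ⇒ B} → IsIso C w → w ∘ f ≈ w ∘ g → f ≈ g
  iso⇒mono {w = w} {f} {g} w-iso eq = begin
    f               ≈⟨ cancelˡ isoˡ ⟨
    inv ∘ (w ∘ f)   ≈⟨ refl⟩∘⟨ eq ⟩
    inv ∘ (w ∘ g)   ≈⟨ cancelˡ isoˡ ⟩
    g               ∎
    where open IsIso w-iso

  iso⇒epi : ∀ {A B D} {w : A ⇒ B} {f g : B ⇒ D} → IsIso C w → f ∘ w ≈ g ∘ w → f ≈ g
  iso⇒epi {w = w} {f} {g} w-iso eq = begin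
    f               ≈⟨ cancelʳ isoʳ ⟨
    (f ∘ w) ∘ inv   ≈⟨ eq ⟩∘⟨refl ⟩
    (g ∘ w) ∘ inv   ≈⟨ cancelʳ isoʳ ⟩
    g               ∎
    where open IsIso w-iso

  id-iso : ∀ {A} → IsIso C (id {A})
  id-iso = record { inv = id ; isoˡ = identityˡ ; isoʳ = identityˡ }

  inv-iso : ∀ {A B} {f : A ⇒ B} (f-iso : IsIso C f) → IsIso C (IsIso.inv f-iso)
  inv-iso {f = f} f-iso = record { inv = f ; isoˡ = isoʳ ; isoʳ = isoˡ }
    where open IsIso f-iso

  ∘-iso : ∀ {A B D} {g : B ⇒ D} {f : A ⇒ B} → IsIso C g → IsIso C f → IsIso C (g ∘ f)
  ∘-iso {g = g} {f} g-iso f-iso = record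
    { inv  = f.inv ∘ g.inv
    ; isoˡ = ≈.trans assoc (≈.trans (refl⟩∘⟨ cancelˡ g.isoˡ) f.isoˡ)
    ; isoʳ = ≈.trans assoc (≈.trans (refl⟩∘⟨ cancelˡ f.isoʳ) g.isoʳ)
    }
    where
    module f = IsIso f-iso
    module g = IsIso g-iso

  Isomorphic-sym : ∀ {A B} → Isomorphic C A B → Isomorphic C B A
  Isomorphic-sym (_ , f-iso) = IsIso.inv f-iso , inv-iso f-iso

-- Members of an iso-graph

module IsoGraphProperties {o ℓ e p} {C : Category o ℓ e} (i : IsoGraph C p) where
  open Category C
  open CategoryProperties C
  open IsoGraph i

  isomorphic⇒member : ∀ {A B} → Isomorphic C A B → ∃ λ (α : A ⇒ B) → Member α
  isomorphic⇒member = ⇔.from (connected _ _)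

  member⇒isomorphic : ∀ {A B} {α : A ⇒ B} → Member α → Isomorphic C A B
  member⇒isomorphic α∈ = ⇔.to (connected _ _) (_ , α∈)

  member-endo : ∀ {A} {α : A ⇒ A} → Member α → α ≈ id
  member-endo α∈ = thin α∈ id∈

  -- Connectedness supplies a member in the opposite direction. Both composites are endomorphisms in
  -- the iso-graph, hence identities by thinness.
  member-iso : ∀ {A B} {α : A ⇒ B} → Member α →
               Σ (IsIso C α) λ α-iso → Member (IsIso.inv α-iso)
  member-iso α∈ =
    let β , β∈ = isomorphic⇒member (Isomorphic-sym (member⇒isomorphic α∈)) in
    record { inv = β ; isoˡ = member-endo (∘∈ β∈ α∈) ; isoʳ = member-endo (∘∈ α∈ β∈) } , β∈

-- Equivalences are fully faithful

module FunctorProperties {o ℓ e o′ ℓ′ e′} {C : Category o ℓ e} {D : Category o′ ℓ′ e′}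
                         (E : Equivalence C D) where
  private
    module C where
      open Category C public
      open CategoryProperties C public
    module D where
      open Category D public
      open CategoryProperties D public
    module F = Functor (Equivalence.F E)
    module G = Functor (Equivalence.G E)
    module unit = NaturalIsomorphism (Equivalence.unit E)
    module counit = NaturalIsomorphism (Equivalence.counit E)

  F-faithful : ∀ {A B} {f g : A C.⇒ B} → F.F₁ f D.≈ F.F₁ g → f C.≈ g
  F-faithful {f = f} {g} eq = C.iso⇒mono (unit.iso _) (begin
    unit.η _ C.∘ f                  ≈⟨ unit.natural f ⟩
    G.F₁ (F.F₁ f) C.∘ unit.η _      ≈⟨ G.F-resp-≈ eq C.⟩∘⟨refl ⟩
    G.F₁ (F.F₁ g) C.∘ unit.η _      ≈⟨ unit.natural g ⟨
    unit.η _ C.∘ g                  ∎)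
    where open C.HomReasoning

  G-faithful : ∀ {A B} {f g : A D.⇒ B} → G.F₁ f C.≈ G.F₁ g → f D.≈ g
  G-faithful {f = f} {g} eq = D.iso⇒epi (counit.iso _) (begin
    f D.∘ counit.η _                ≈⟨ counit.natural f ⟨
    counit.η _ D.∘ F.F₁ (G.F₁ f)    ≈⟨ D.refl⟩∘⟨ F.F-resp-≈ eq ⟩
    counit.η _ D.∘ F.F₁ (G.F₁ g)    ≈⟨ counit.natural g ⟩
    g D.∘ counit.η _                ∎)
    where open D.HomReasoning

  -- Since `G` is faithful, the equation may be checked after applying `G`. The preimage is `G.F₁ h`
  -- conjugated by the unit, so naturality of the unit gives exactly that equation.
  F-full : ∀ {A B} (h : F.F₀ A D.⇒ F.F₀ B) → ∃ λ f → F.F₁ f D.≈ h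
  F-full {A} {B} h = f , G-faithful (C.iso⇒epi (unit.iso A) (begin
    G.F₁ (F.F₁ f) C.∘ unit.η A      ≈⟨ unit.natural f ⟨
    unit.η B C.∘ f                  ≈⟨ C.cancelˡ (IsIso.isoʳ (unit.iso B)) ⟩
    G.F₁ h C.∘ unit.η A             ∎))
    where
    open C.HomReasoning
    f = IsIso.inv (unit.iso B) C.∘ (G.F₁ h C.∘ unit.η A)

-- Links, the correspondence of morphisms over them, and coherence

module Links {o ℓ e o′ ℓ′ e′ p p′} {C : Category o ℓ e} {D : Category o′ ℓ′ e′}
             (E : Equivalence C D) (i : IsoGraph C p) (j : IsoGraph D p′) where
  open FunctorProperties E
  private
    module C where
      open Category C public
      open CategoryProperties C public
    module D where
      open Category D public
      open CategoryProperties D public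
    module F = Functor (Equivalence.F E)
    module counit = NaturalIsomorphism (Equivalence.counit E)
    module i where
      open IsoGraph i public
      open IsoGraphProperties i public
    module j where
      open IsoGraph j public
      open IsoGraphProperties j public

  record Link : Set (o ⊔ o′ ⊔ ℓ′ ⊔ e′) where
    constructor link
    field
      {source} : C.Obj
      {target} : D.Obj
      {map}    : F.F₀ source D.⇒ target
      map-iso  : IsIso D map

  open Link

  -- A commuting square rather than a function: `F` is fully faithful and the maps are invertible,
  -- so this relation is the graph of a bijection of hom-sets up to `≈`, and both directions can be
  -- used alike.
  Over : (x y : Link) → source x C.⇒ source y → target x D.⇒ target y → Set e′
  Over x y f f′ = map y D.∘ F.F₁ f D.≈ f′ D.∘ map x

  over-id : ∀ x → Over x x C.id D.id
  over-id x = D.≈.trans (D.refl⟩∘⟨ F.identity) (D.≈.trans D.identityʳ (D.≈.sym D.identityˡ))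

  over-∘ : ∀ x y z {f f′ g g′} → Over y z g g′ → Over x y f f′ →
           Over x z (g C.∘ f) (g′ D.∘ f′)
  over-∘ x y z {f} {f′} {g} {g′} g~ f~ = begin
    map z D.∘ F.F₁ (g C.∘ f)            ≈⟨ D.refl⟩∘⟨ F.homomorphism ⟩
    map z D.∘ (F.F₁ g D.∘ F.F₁ f)       ≈⟨ D.assoc ⟨
    (map z D.∘ F.F₁ g) D.∘ F.F₁ f       ≈⟨ g~ D.⟩∘⟨refl ⟩
    (g′ D.∘ map y) D.∘ F.F₁ f           ≈⟨ D.assoc ⟩
    g′ D.∘ (map y D.∘ F.F₁ f)           ≈⟨ D.refl⟩∘⟨ f~ ⟩
    g′ D.∘ (f′ D.∘ map x)               ≈⟨ D.assoc ⟨
    (g′ D.∘ f′) D.∘ map x               ∎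
    where open D.HomReasoning

  over-respˡ : ∀ x y {f g f′} → f C.≈ g → Over x y f f′ → Over x y g f′
  over-respˡ x y eq = D.≈.trans (D.refl⟩∘⟨ F.F-resp-≈ (C.≈.sym eq))

  over-respʳ : ∀ x y {f f′ g′} → f′ D.≈ g′ → Over x y f f′ → Over x y f g′
  over-respʳ x y eq f~ = D.≈.trans f~ (eq D.⟩∘⟨refl)

  over-functional : ∀ x y {f g f′ g′} → Over x y f f′ → Over x y g g′ →
                    f C.≈ g → f′ D.≈ g′
  over-functional x y f~ g~ eq =
    D.iso⇒epi (map-iso x) (D.≈.trans (D.≈.sym (over-respˡ x y eq f~)) g~)

  over-injective : ∀ x y {f g f′ g′} → Over x y f f′ → Over x y g g′ →
                   f′ D.≈ g′ → f C.≈ g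
  over-injective x y f~ g~ eq =
    F-faithful (D.iso⇒mono (map-iso y) (D.≈.trans (over-respʳ x y eq f~) (D.≈.sym g~)))

  over-total : ∀ x y f → ∃ λ f′ → Over x y f f′
  over-total x y f =
    (map y D.∘ F.F₁ f) D.∘ IsIso.inv (map-iso x) ,
    D.≈.sym (D.cancelʳ (IsIso.isoˡ (map-iso x)))

  over-surjective : ∀ x y f′ → ∃ λ f → Over x y f f′
  over-surjective x y f′ =
    let f , eq = F-full (IsIso.inv (map-iso y) D.∘ (f′ D.∘ map x)) in
    f , D.≈.trans (D.refl⟩∘⟨ eq) (D.cancelˡ (IsIso.isoʳ (map-iso y)))

  isomorphic-targets : ∀ x y → Isomorphic C (source x) (source y) →
                       Isomorphic D (target x) (target y)
  isomorphic-targets x y (f , f-iso) =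
    let open IsIso f-iso
        f′ , f~ = over-total x y f
        g′ , g~ = over-total y x inv
    in f′ , record
      { inv  = g′
      ; isoˡ = over-functional x x (over-∘ x y x g~ f~) (over-id x) isoˡ
      ; isoʳ = over-functional y y (over-∘ y x y f~ g~) (over-id y) isoʳ
      }

  isomorphic-sources : ∀ x y → Isomorphic D (target x) (target y) →
                       Isomorphic C (source x) (source y)
  isomorphic-sources x y (f′ , f′-iso) =
    let open IsIso f′-iso
        f , f~ = over-surjective x y f′
        g , g~ = over-surjective y x inv
    in f , record
      { inv  = g
      ; isoˡ = over-injective x x (over-∘ x y x g~ f~) (over-id x) isoˡ
      ; isoʳ = over-injective y y (over-∘ y x y f~ g~) (over-id y) isoʳ
      }

  -- Only the passage from `i` to `j` is required; `coherent-back` recovers the converse. The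
  -- condition is vacuous when the sources are not isomorphic.
  Coherent : Link → Link → Set _
  Coherent x y = ∀ {α} → i.Member α → ∃ λ β → j.Member β × Over x y α β

  coherent-refl : ∀ x → Coherent x x
  coherent-refl x α∈ = D.id , j.id∈ , over-respˡ x x (C.≈.sym (i.member-endo α∈)) (over-id x)

  coherent-sym : ∀ x y → Coherent x y → Coherent y x
  coherent-sym x y coh {γ} γ∈ =
    let γ-iso , γ⁻¹∈    = i.member-iso γ∈
        β , β∈ , β~     = coh γ⁻¹∈
        β-iso , β⁻¹∈    = j.member-iso β∈
        γ′ , γ~         = over-total y x γ
        -- Both sides lie over `id`, since `β` lies over the inverse of `γ`. Hence `γ′` is the
        -- inverse of `β`, which is a member of `j`.
        βγ′≈id          = over-functional y y (over-∘ y x y β~ γ~) (over-id y) (IsIso.isoˡ γ-iso)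
        γ′≈β⁻¹          = D.iso⇒mono β-iso (D.≈.trans βγ′≈id (D.≈.sym (IsIso.isoʳ β-iso)))
    in IsIso.inv β-iso , β⁻¹∈ , over-respʳ y x γ′≈β⁻¹ γ~

  -- The member `α` allows `γ` to be factored through `source y` as `(γ ∘ α⁻¹) ∘ α`, whose two
  -- factors are members to which the hypotheses apply. Without such an `α`, coherence of `x` with
  -- `y` could be vacuous and say nothing about `z`.
  coherent-trans : ∀ x y z {α : source x C.⇒ source y} → i.Member α →
                   Coherent x y → Coherent y z → Coherent x z
  coherent-trans x y z α∈ xy yz γ∈ =
    let α-iso , α⁻¹∈    = i.member-iso α∈
        β₁ , β₁∈ , β₁~  = xy α∈
        β₂ , β₂∈ , β₂~  = yz (i.∘∈ γ∈ α⁻¹∈)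
    in β₂ D.∘ β₁ , j.∘∈ β₂∈ β₁∈ ,
       over-respˡ x z (C.cancelʳ (IsIso.isoˡ α-iso)) (over-∘ x y z β₂~ β₁~)

  -- A member `β` makes the targets, hence the sources, isomorphic, so there is a member `α` between
  -- the sources. Thinness of `j` identifies its partner with `β`.
  coherent-back : ∀ x y → Coherent x y → ∀ {β} → j.Member β →
                  ∃ λ α → i.Member α × Over x y α β
  coherent-back x y coh β∈ =
    let α , α∈        = i.isomorphic⇒member (isomorphic-sources x y (j.member⇒isomorphic β∈))
        β₁ , β₁∈ , α~ = coh α∈
    in α , α∈ , over-respʳ x y (j.thin β₁∈ β∈) α~

  AllCoherent : List Link → Set _
  AllCoherent L = ∀ {x y} → x ∈ L → y ∈ L → Coherent x y

  extend : ∀ {L} x → AllCoherent L → (∀ {y} → y ∈ L → Coherent x y) → AllCoherent (x ∷ L)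
  extend x L-coh x-coh (here refl) (here refl) = coherent-refl x
  extend x L-coh x-coh (here refl) (there y∈)  = x-coh y∈
  extend x L-coh x-coh {y} (there y∈) (here refl) = coherent-sym x y (x-coh y∈)
  extend x L-coh x-coh (there y∈)  (there z∈)  = L-coh y∈ z∈

  -- Related morphisms and quasi-composition

  Related : List Link → Arrow C → Arrow D → Set _
  Related L (arrow {A} {B} f) (arrow {A′} {B′} f′) =
    Σ (F.F₀ A D.⇒ A′) λ v → Σ (F.F₀ B D.⇒ B′) λ w →
    Σ (IsIso D v) λ v-iso → Σ (IsIso D w) λ w-iso →
      link v-iso ∈ L × link w-iso ∈ L × Over (link v-iso) (link w-iso) f f′

  related-mono : ∀ {L L′} → L ⊆ L′ → ∀ {x y} → Related L x y → Related L′ x y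
  related-mono sub (v , w , v-iso , w-iso , v∈ , w∈ , f~) =
    v , w , v-iso , w-iso , sub v∈ , sub w∈ , f~

  -- Coherence pairs the connecting members `α`, `γ`, `δ` with members of `j`. Pasting squares puts
  -- each side of the equation in `D` over the same side in `C`, between the same two links, so one
  -- equation holds exactly when the other does.
  related-QC : ∀ {L} → AllCoherent L → ∀ {f g h f′ g′ h′} →
               Related L f f′ → Related L g g′ → Related L h h′ →
               QC C i f g h ⇔ QC D j f′ g′ h′
  related-QC L-coh
    (_ , _ , a , b , a∈ , b∈ , f~) (_ , _ , c , d , c∈ , d∈ , g~) (_ , _ , p , q , p∈ , q∈ , h~)
    = mk⇔
      (λ (α , γ , δ , α∈ , γ∈ , δ∈ , eq) →
        let α′ , α′∈ , α~ = L-coh p∈ a∈ α∈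
            γ′ , γ′∈ , γ~ = L-coh b∈ c∈ γ∈
            δ′ , δ′∈ , δ~ = L-coh q∈ d∈ δ∈
        in α′ , γ′ , δ′ , α′∈ , γ′∈ , δ′∈ ,
           over-functional P Q′ (lhs δ~) (rhs γ~ α~) eq)
      (λ (α′ , γ′ , δ′ , α′∈ , γ′∈ , δ′∈ , eq) →
        let α , α∈ , α~ = coherent-back P A (L-coh p∈ a∈) α′∈
            γ , γ∈ , γ~ = coherent-back B C′ (L-coh b∈ c∈) γ′∈
            δ , δ∈ , δ~ = coherent-back Q Q′ (L-coh q∈ d∈) δ′∈
        in α , γ , δ , α∈ , γ∈ , δ∈ ,
           over-injective P Q′ (lhs δ~) (rhs γ~ α~) eq)
    where
    A = link a ; B = link b ; C′ = link c ; Q′ = link d ; P = link p ; Q = link q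
    lhs : ∀ {δ δ′} → Over Q Q′ δ δ′ → Over P Q′ _ _
    lhs δ~ = over-∘ P Q Q′ δ~ h~
    rhs : ∀ {γ γ′ α α′} → Over B C′ γ γ′ → Over P A α α′ → Over P Q′ _ _
    rhs γ~ α~ = over-∘ P C′ Q′ g~ (over-∘ P B C′ γ~ (over-∘ P A B f~ α~))

  -- Extending a coherent list of links, and the resulting back-and-forth system

  module _ (em : ∀ {a} → ExcludedMiddle a) where

    link-source : ∀ {L} → AllCoherent L → ∀ A →
                  ∃ λ L′ → L ⊆ L′ × AllCoherent L′ ×
                  ∃₂ λ A′ (w : F.F₀ A D.⇒ A′) → Σ (IsIso D w) λ w-iso → link w-iso ∈ L′
    link-source {L} L-coh A
      with em {P = ∃ λ z → z ∈ L × ∃ λ (α : A C.⇒ source z) → i.Member α}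
    -- The new link is `map z` after `F.F₁ α`, with the target of `z`. It is chosen so that `α` lies
    -- over `id`; thinness makes `α` the only member to check, and coherence with the other links
    -- follows through `z`.
    ... | yes (z , z∈ , α , α∈) =
      x ∷ L , there ,
      extend x L-coh (λ {y} y∈ → coherent-trans x z y α∈ xz (L-coh z∈ y∈)) ,
      _ , _ , map-iso x , here refl
      where
      α-iso = proj₁ (i.member-iso α∈)
      Fα-iso : IsIso D (F.F₁ α)
      Fα-iso = record
        { inv  = F.F₁ (IsIso.inv α-iso)
        ; isoˡ = D.≈.trans (D.≈.sym F.homomorphism)
                   (D.≈.trans (F.F-resp-≈ (IsIso.isoˡ α-iso)) F.identity)
        ; isoʳ = D.≈.trans (D.≈.sym F.homomorphism)
                   (D.≈.trans (F.F-resp-≈ (IsIso.isoʳ α-iso)) F.identity)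
        }
      x = link (D.∘-iso (map-iso z) Fα-iso)
      xz : Coherent x z
      xz γ∈ = D.id , j.id∈ ,
        D.≈.trans (D.refl⟩∘⟨ F.F-resp-≈ (i.thin γ∈ α∈)) (D.≈.sym D.identityˡ)
    -- No member leads from `A` to a listed source, so coherence of any link at `A` with the list is
    -- vacuous and the identity of `F.F₀ A` will do.
    ... | no ¬z =
      x ∷ L , there ,
      extend x L-coh (λ {y} y∈ α∈ → contradiction (y , y∈ , _ , α∈) ¬z) ,
      _ , _ , map-iso x , here refl
      where x = link (D.id-iso {F.F₀ A})

    link-target : ∀ {L} → AllCoherent L → ∀ A′ →
                  ∃ λ L′ → L ⊆ L′ × AllCoherent L′ ×
                  ∃₂ λ A (w : F.F₀ A D.⇒ A′) → Σ (IsIso D w) λ w-iso → link w-iso ∈ L′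
    link-target {L} L-coh A′
      with em {P = ∃ λ z → z ∈ L × ∃ λ (β : target z D.⇒ A′) → j.Member β}
    -- The new link keeps the source of `z` and follows `map z` by `β`, so that `id` lies over `β`.
    -- Coherence with the other links again passes through `z`.
    ... | yes (z , z∈ , β , β∈) =
      x ∷ L , there ,
      extend x L-coh
        (λ {y} y∈ → coherent-trans x z y i.id∈ (coherent-sym z x zx) (L-coh z∈ y∈)) ,
      _ , _ , map-iso x , here refl
      where
      x = link (D.∘-iso (proj₁ (j.member-iso β∈)) (map-iso z))
      zx : Coherent z x
      zx α∈ = β , β∈ , over-respˡ z x (C.≈.sym (i.member-endo α∈))
        (D.≈.trans (D.refl⟩∘⟨ F.identity) D.identityʳ)
    -- The counit links `A′` to its image under `G`. A member from this source to a listed one would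
    -- make the targets isomorphic, and so yield the member of `j` that was excluded.
    ... | no ¬z =
      x ∷ L , there ,
      extend x L-coh (λ {y} y∈ α∈ → contradiction
        (y , y∈ , j.isomorphic⇒member
          (D.Isomorphic-sym (isomorphic-targets x y (i.member⇒isomorphic α∈)))) ¬z) ,
      _ , _ , map-iso x , here refl
      where x = link (counit.iso A′)

    backAndForth : BackAndForth (QC C i) (QC D j) _
    backAndForth = record
      { _∼_   = λ ρ τ → ∃ λ L → AllCoherent L × Pointwise (Related L) ρ τ
      ; atoms = λ (L , L-coh , rs) x y z → related-QC L-coh
                  (Pointwise.lookup rs x) (Pointwise.lookup rs y) (Pointwise.lookup rs z)
      ; forth = λ (L , L-coh , rs) (arrow {A} {B} f) →
          let L₁ , sub₁ , coh₁ , _ , v , v-iso , v∈ = link-source L-coh A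
              L₂ , sub₂ , coh₂ , _ , w , w-iso , w∈ = link-source coh₁ B
              f′ , f~ = over-total (link v-iso) (link w-iso) f
          in arrow f′ , L₂ , coh₂ ,
             (v , w , v-iso , w-iso , sub₂ v∈ , w∈ , f~) ∷
             Pointwise.map (related-mono (sub₂ ∘′ sub₁)) rs
      ; back  = λ (L , L-coh , rs) (arrow {A} {B} f′) →
          let L₁ , sub₁ , coh₁ , _ , v , v-iso , v∈ = link-target L-coh A
              L₂ , sub₂ , coh₂ , _ , w , w-iso , w∈ = link-target coh₁ B
              f , f~ = over-surjective (link v-iso) (link w-iso) f′
          in arrow f , L₂ , coh₂ ,
             (v , w , v-iso , w-iso , sub₂ v∈ , w∈ , f~) ∷
             Pointwise.map (related-mono (sub₂ ∘′ sub₁)) rs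
      }

theorem9p5 : (∀ {a} → ExcludedMiddle a) →
    ∀ {o ℓ e p o′ ℓ′ e′ p′}
    (C : Category o ℓ e) (D : Category o′ ℓ′ e′) →
    Equivalence C D →
    (i : IsoGraph C p) (j : IsoGraph D p′) →
    (σ : Sentence) → Holds C i σ ⇔ Holds D j σ
theorem9p5 em C D E i j σ = mk⇔ (satisfies-to start σ) (satisfies-from start σ)
  where
  open BackAndForth (Links.backAndForth E i j em)
  start : [] ∼ []
  -- With no free variables there is nothing to link, and the empty list is coherent vacuously.
  start = [] , (λ ()) , []
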